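{- $\mathsf{RT}^1_3\le_\mathrm{sW}\mathsf{ADC}$.
   Context: Problems are multi-valued partial functions $\subseteq\omega^\omega\rightrightarrows\omega^\omega$ with standard codings. $\mathcal{F}\le_\mathrm{sW}\mathcal{G}$ if there are Turing functionals $\Phi,\Psi$ with $\Phi(f)\in\mathrm{dom}(\mathcal{G})$ for all $f\in\mathrm{dom}(\mathcal{F})$ and $\Psi(g)\in\mathcal{F}(f)$ for all $f\in\mathrm{dom}(\mathcal F)$, $g\in\mathcal{G}(\Phi(f))$. $\mathsf{RT}^1_3$: input $c\colon\omega\to\{0,1,2\}$; output an infinite $H\subseteq\omega$ on which $c$ is constant. $\mathsf{ADC}$: input an infinite linear order $(L,<_L)$ with $L\subseteq\omega$; output an infinite $S\subseteq L$ that is an ascending chain ($\{x\in S:x<_Ly\}$ finite for every $y\in S$) or a descending chain ($\{x\in S:y<_Lx\}$ finite for every $y\in S$). -}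

module Defs where

open import Data.Nat using (ℕ; zero; suc; _+_; _≤_; _<_)
open import Data.Fin using (Fin)
open import Data.Vec using (Vec; []; _∷_; lookup)
open import Data.Product using (Σ; ∃; _×_)
open import Data.Sum using (_⊎_)
open import Relation.Binary.PropositionalEquality using (_≡_; _≢_)

Baire : Set
Baire = ℕ → ℕ

-- Turing functionals: codes of partial recursive functions with an
-- oracle (Kleene's oracle μ-recursive functions).  A code is a finite
-- syntactic object, so only countably many functionals exist and they
-- are exactly the Turing functionals.

data Code : ℕ → Set where
  zer : ∀ {n} → Code n
  sucᶜ : Code 1
  prj : ∀ {n} → Fin n → Code n
  orc : Code 1
  cmp : ∀ {m n} → Code m → Vec (Code n) m → Code n
  rec : ∀ {n} → Code n → Code (suc (suc n)) → Code (suc n)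
  mnz : ∀ {n} → Code (suc n) → Code n

-- Big-step semantics relative to the oracle f (partial: a computation
-- converges iff a derivation exists).
mutual
  data Eval (f : Baire) : ∀ {n} → Code n → Vec ℕ n → ℕ → Set where
    ev-zer : ∀ {n} {xs : Vec ℕ n} → Eval f zer xs 0
    ev-suc : ∀ {x} → Eval f sucᶜ (x ∷ []) (suc x)
    ev-prj : ∀ {n} {i : Fin n} {xs : Vec ℕ n} → Eval f (prj i) xs (lookup xs i)
    ev-orc : ∀ {x} → Eval f orc (x ∷ []) (f x)
    ev-cmp : ∀ {m n} {h : Code m} {gs : Vec (Code n) m} {xs : Vec ℕ n}
               {ys : Vec ℕ m} {z : ℕ} →
             Evals f gs xs ys → Eval f h ys z → Eval f (cmp h gs) xs z
    ev-rec0 : ∀ {n} {g : Code n} {h : Code (suc (suc n))} {xs : Vec ℕ n} {z : ℕ} →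
              Eval f g xs z → Eval f (rec g h) (0 ∷ xs) z
    ev-recS : ∀ {n} {g : Code n} {h : Code (suc (suc n))} {xs : Vec ℕ n}
                {k z w : ℕ} →
              Eval f (rec g h) (k ∷ xs) z → Eval f h (k ∷ z ∷ xs) w →
              Eval f (rec g h) (suc k ∷ xs) w
    ev-mnz : ∀ {n} {g : Code (suc n)} {xs : Vec ℕ n} {y : ℕ} →
             Eval f g (y ∷ xs) 0 →
             (∀ z → z < y → ∃ λ v → Eval f g (z ∷ xs) (suc v)) →
             Eval f (mnz g) xs y

  data Evals (f : Baire) : ∀ {m n} → Vec (Code n) m → Vec ℕ n → Vec ℕ m → Set where
    evs-[] : ∀ {n} {xs : Vec ℕ n} → Evals f [] xs []
    evs-∷ : ∀ {m n} {g : Code n} {gs : Vec (Code n) m} {xs : Vec ℕ n}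
              {y : ℕ} {ys : Vec ℕ m} →
            Eval f g xs y → Evals f gs xs ys → Evals f (g ∷ gs) xs (y ∷ ys)

_⟦_⟧≡_ : Code 1 → Baire → Baire → Set
e ⟦ f ⟧≡ g = ∀ n → Eval f e (n ∷ []) (g n)

record Problem : Set₁ where
  field
    dom : Baire → Set
    sol : Baire → Baire → Set     -- sol f g : g ∈ P(f)

open Problem

_≤sW_ : Problem → Problem → Set
F ≤sW G = Σ (Code 1) λ Φ → Σ (Code 1) λ Ψ →
  ∀ f → dom F f →
    Σ Baire λ d → (Φ ⟦ f ⟧≡ d) × dom G d ×
      (∀ g → sol G d g → Σ Baire λ h → (Ψ ⟦ g ⟧≡ h) × sol F f h)

IsSetCode : Baire → Set
IsSetCode s = ∀ n → s n ≤ 1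

_∈ₛ_ : ℕ → Baire → Set
x ∈ₛ s = s x ≡ 1

InfiniteSet : Baire → Set
InfiniteSet s = ∀ n → ∃ λ m → n ≤ m × m ∈ₛ s

RT13 : Problem
RT13 = record
  { dom = λ c → ∀ n → c n < 3
  ; sol = λ c h → IsSetCode h × InfiniteSet h ×
                  ∃ λ i → ∀ m → m ∈ₛ h → c m ≡ i
  }

-- ADC.  Pairing ⟨x,y⟩ (Cantor) and linear orders coded by the
-- characteristic function of ≤_L on ω (x ∈ L iff x ≤_L x).

tri : ℕ → ℕ
tri zero = zero
tri (suc k) = suc k + tri k

pair : ℕ → ℕ → ℕ
pair x y = tri (x + y) + y

module LinOrd (d : Baire) where
  _≤L_ : ℕ → ℕ → Set
  x ≤L y = d (pair x y) ≡ 1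

  InL : ℕ → Set
  InL x = x ≤L x

  _<L_ : ℕ → ℕ → Set
  x <L y = x ≤L y × x ≢ y

  IsLinearOrder : Set
  IsLinearOrder =
    (∀ n → d n ≤ 1) ×
    (∀ x y → x ≤L y → InL x × InL y) ×
    (∀ x y → x ≤L y → y ≤L x → x ≡ y) ×
    (∀ x y z → x ≤L y → y ≤L z → x ≤L z) ×
    (∀ x y → InL x → InL y → x ≤L y ⊎ y ≤L x)

  InfiniteL : Set
  InfiniteL = ∀ n → ∃ λ m → n ≤ m × InL m

  FinBelow : Baire → ℕ → Set
  FinBelow s y = ∃ λ b → ∀ x → x ∈ₛ s → x <L y → x < b

  FinAbove : Baire → ℕ → Set
  FinAbove s y = ∃ λ b → ∀ x → x ∈ₛ s → y <L x → x < b

  Ascending : Baire → Set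
  Ascending s = ∀ y → y ∈ₛ s → FinBelow s y

  Descending : Baire → Set
  Descending s = ∀ y → y ∈ₛ s → FinAbove s y

ADC : Problem
ADC = record
  { dom = λ d → LinOrd.IsLinearOrder d × LinOrd.InfiniteL d
  ; sol = λ d s → IsSetCode s × InfiniteSet s ×
                  (∀ x → x ∈ₛ s → LinOrd.InL d x) ×
                  (LinOrd.Ascending d s ⊎ LinOrd.Descending d s)
  }

{-# OPTIONS --safe #-}
module Submission where

-- Scan a 3-colouring f with a counter, the phase, that goes up by one whenever the
-- colour read equals the phase modulo 3; the point read belongs to the new phase, so
-- phase p contains only the colours p + 1 and p + 2 modulo 3.  Each phase is placed
-- around all the earlier ones: its points of colour p + 1 form an ascending sequence
-- below them, those of colour p + 2 a descending sequence above them.  Consider a point of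
-- an ascending chain.  If a later point of the chain above it is a lower one, both lie in
-- the lower half of the same phase and so have the same colour.  If it is an upper one,
-- then all later points of the chain are upper points of ever larger phases, and an
-- unbounded phase forces every colour to recur.  Hence the colour of each point of the
-- chain recurs in f; descending chains are dual.  The n-th point is coded by n together
-- with f 0, …, f n, so a chain computes f, and with it the set of all numbers of the colour
-- of its first element.

open import Defs
open import Data.Nat using
  (ℕ; zero; suc; pred; _+_; _*_; _∸_; _%_; _⊔_; _≤_; _<_; _≥_; z≤n; s≤s; _≤′_; ≤′-refl; ≤′-step)
open import Data.Nat.Properties
open import Data.Nat.DivMod using ([m+kn]%n≡m%n; m<n⇒m%n≡m)
open import Data.Nat.GeneralisedArithmetic using (fold)
open import Data.Fin using (Fin)
open import Data.Fin.Patterns using (0F; 1F; 2F)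
open import Data.Vec using (Vec; []; _∷_; head; tail; lookup; map)
open import Data.Vec.Relation.Unary.All using (All; []; _∷_; reduce)
open import Data.Product as Product using (∃; _×_; _,_; proj₁; proj₂)
open import Data.Product.Relation.Binary.Pointwise.NonDependent using (Pointwise)
open import Data.Product.Relation.Binary.Lex.Strict using
  (×-Lex; ×-transitive; ×-antisymmetric; ×-total₂; ×-decidable)
open import Data.Sum as Sum using (_⊎_; inj₁; inj₂; [_,_])
open import Function using (id; _∘_; flip)
open import Level using (0ℓ)
open import Relation.Binary using (Rel; Transitive; Antisymmetric; Total; IsTotalOrder; _Preserves_⟶_)
open import Relation.Nullary using (¬_; Dec; yes; no; ¬?; _×-dec_; _⊎-dec_; _→-dec_; contradiction)
open import Relation.Nullary.Decidable using (toSum)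
open import Relation.Binary.PropositionalEquality using
  (_≡_; _≢_; refl; sym; trans; cong; cong₂; subst; subst₂; isEquivalence; module ≡-Reasoning)

InfinitelyOften : (ℕ → Set) → Set
InfinitelyOften P = ∀ n → ∃ λ m → n ≤ m × P m

-- Indicators and least witnesses

indicator : {P : Set} → Dec P → ℕ
indicator (yes _) = 1
indicator (no _)  = 0

module _ {P : Set} where

  indicator≤1 : (P? : Dec P) → indicator P? ≤ 1
  indicator≤1 (yes _) = ≤-refl
  indicator≤1 (no _)  = z≤n

  indicator≡1⇒ : (P? : Dec P) → indicator P? ≡ 1 → P
  indicator≡1⇒ (yes p) _ = p

  indicator-true : (P? : Dec P) → P → indicator P? ≡ 1
  indicator-true (yes _) _ = refl
  indicator-true (no ¬p) p = contradiction p ¬p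

  indicator-false : (P? : Dec P) → ¬ P → indicator P? ≡ 0
  indicator-false (yes p) ¬p = contradiction p ¬p
  indicator-false (no _)  _  = refl

  indicator-¬ : (P? : Dec P) → indicator (¬? P?) ≡ 1 ∸ indicator P?
  indicator-¬ (yes _) = refl
  indicator-¬ (no _)  = refl

module _ {P Q : Set} where

  indicator-× : (P? : Dec P) (Q? : Dec Q) → indicator (P? ×-dec Q?) ≡ indicator P? * indicator Q?
  indicator-× (yes _) (yes _) = refl
  indicator-× (yes _) (no _)  = refl
  indicator-× (no _)  _       = refl

  indicator-⊎ : (P? : Dec P) (Q? : Dec Q) →
                indicator (P? ⊎-dec Q?) ≡ 1 ∸ (1 ∸ indicator P?) * (1 ∸ indicator Q?)
  indicator-⊎ (yes _) _       = refl
  indicator-⊎ (no _)  (yes _) = refl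
  indicator-⊎ (no _)  (no _)  = refl

  indicator-→ : (P? : Dec P) (Q? : Dec Q) →
                indicator (P? →-dec Q?) ≡ 1 ∸ indicator P? * (1 ∸ indicator Q?)
  indicator-→ (yes _) (yes _) = refl
  indicator-→ (yes _) (no _)  = refl
  indicator-→ (no _)  _       = refl

indicator-≤ : ∀ m n → indicator (m ≤? n) ≡ 1 ∸ (m ∸ n)
indicator-≤ m n with m ≤? n
... | yes m≤n = sym (cong (1 ∸_) (m≤n⇒m∸n≡0 m≤n))
... | no  m≰n = sym (m≤n⇒m∸n≡0 (m<n⇒0<n∸m (≰⇒> m≰n)))

indicator-≡ : ∀ m n → indicator (m ≟ n) ≡ indicator (m ≤? n ×-dec n ≤? m)
indicator-≡ m n with m ≟ n
... | yes refl = sym (indicator-true  (m ≤? n ×-dec n ≤? m) (≤-refl , ≤-refl))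
... | no  m≢n  = sym (indicator-false (m ≤? n ×-dec n ≤? m) λ (m≤n , n≤m) → m≢n (≤-antisym m≤n n≤m))

IsLeast : (ℕ → Set) → ℕ → Set
IsLeast P n = P n × (∀ {m} → m < n → ¬ P m)

isLeast-unique : ∀ {P m n} → IsLeast P m → IsLeast P n → m ≡ n
isLeast-unique (Pm , m-least) (Pn , n-least) =
  ≤-antisym (≮⇒≥ λ n<m → m-least n<m Pn) (≮⇒≥ λ m<n → n-least m<n Pm)

least : ∀ {P : ℕ → Set} → (∀ n → Dec (P n)) → ∀ n → P n → ∃ (IsLeast P)
least P? n Pn with P? 0
... | yes P0 = 0 , P0 , λ ()
least P? zero    P0 | no ¬P0 = contradiction P0 ¬P0
least P? (suc n) Pn | no ¬P0 with m , Pm , minimal ← least (P? ∘ suc) n Pn =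
  suc m , Pm , λ { {zero} _ → ¬P0 ; {suc k} (s≤s k<m) → minimal k<m }

module _ {P : ℕ → Set} (P? : ∀ n → Dec (P n)) (witness : ∃ P) where

  -- Abstract so that the searches inside unpair₁ and unpair₂ never unfold.
  abstract

    μ : ℕ
    μ = proj₁ (least P? (proj₁ witness) (proj₂ witness))

    μ-isLeast : IsLeast P μ
    μ-isLeast = proj₂ (least P? (proj₁ witness) (proj₂ witness))

-- Monotone sequences

step⇒mono : ∀ (v : ℕ → ℕ) → (∀ n → v n ≤ v (suc n)) → v Preserves _≤_ ⟶ _≤_
step⇒mono v v-step m≤n = along (≤⇒≤′ m≤n)
  where
  along : ∀ {m n} → m ≤′ n → v m ≤ v n
  along ≤′-refl        = ≤-refl
  along (≤′-step m≤′n) = ≤-trans (along m≤′n) (v-step _)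

crossing : ∀ (v : ℕ → ℕ) {a b u} → a ≤′ b → v a ≤ u → u < v b → ∃ λ m → a ≤ m × v m ≤ u × u < v (suc m)
crossing v ≤′-refl va≤u u<vb = contradiction u<vb (≤⇒≯ va≤u)
crossing v {u = u} (≤′-step {b} a≤′b) va≤u u<v[1+b] with v b ≤? u
... | yes vb≤u = b , ≤′⇒≤ a≤′b , vb≤u , u<v[1+b]
... | no  vb≰u = crossing v a≤′b va≤u (≰⇒> vb≰u)

-- Cantor unpairing

tri-mono-≤ : tri Preserves _≤_ ⟶ _≤_
tri-mono-≤ = step⇒mono tri λ n → m≤n+m (tri n) (suc n)

n≤tri : ∀ n → n ≤ tri n
n≤tri zero    = z≤n
n≤tri (suc n) = m≤m+n (suc n) (tri n)

pair-mono-≤ : ∀ {x x′ y y′} → x ≤ x′ → y ≤ y′ → pair x y ≤ pair x′ y′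
pair-mono-≤ x≤x′ y≤y′ = +-mono-≤ (tri-mono-≤ (+-mono-≤ x≤x′ y≤y′)) y≤y′

x≤pair : ∀ x y → x ≤ pair x y
x≤pair x y = ≤-trans (m≤m+n x y) (≤-trans (n≤tri (x + y)) (m≤m+n (tri (x + y)) y))

y≤pair : ∀ x y → y ≤ pair x y
y≤pair x y = m≤n+m y (tri (x + y))

diagonal unpair₁ unpair₂ : ℕ → ℕ
diagonal p = μ (λ d → p <? tri (suc d)) (p , n≤tri (suc p))
unpair₂ p  = p ∸ tri (diagonal p)
unpair₁ p  = diagonal p ∸ unpair₂ p

module _ (x y : ℕ) where

  diagonal-pair : diagonal (pair x y) ≡ x + y
  diagonal-pair = isLeast-unique (μ-isLeast (λ d → pair x y <? tri (suc d)) _) (pair<tri , tri≤pair)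
    where
    pair<tri : pair x y < tri (suc (x + y))
    pair<tri = s≤s (≤-trans (+-monoʳ-≤ (tri (x + y)) (m≤n+m y x)) (≤-reflexive (+-comm (tri (x + y)) (x + y))))

    tri≤pair : ∀ {d} → d < x + y → ¬ pair x y < tri (suc d)
    tri≤pair d<x+y = ≤⇒≯ (≤-trans (tri-mono-≤ d<x+y) (m≤m+n (tri (x + y)) y))

  unpair₂-pair : unpair₂ (pair x y) ≡ y
  unpair₂-pair = trans (cong (λ d → pair x y ∸ tri d) diagonal-pair) (m+n∸m≡n (tri (x + y)) y)

  unpair₁-pair : unpair₁ (pair x y) ≡ x
  unpair₁-pair = trans (cong₂ _∸_ diagonal-pair unpair₂-pair) (m+n∸n≡m x y)

-- Computability by one code, uniformly over a family of oracles

-- F is a function of the index, not of the oracle, so it may be specified through data,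
-- such as the colouring behind the order in which a chain lies, that the code cannot query.
record Computable {I : Set} (oracle : I → Baire) {n : ℕ} (F : I → Vec ℕ n → ℕ) : Set where
  constructor computable
  field
    code      : Code n
    evaluates : ∀ i xs → Eval (oracle i) code xs (F i xs)

open Computable

record ComputableDec {I : Set} (oracle : I → Baire) {n : ℕ} {P : I → Vec ℕ n → Set}
                     (P? : ∀ i xs → Dec (P i xs)) : Set where
  constructor computableDec
  field
    indicatorᶜ : Computable oracle (λ i xs → indicator (P? i xs))

open ComputableDec

private
  variable
    I : Set
    oracle : I → Baire
    k n : ℕ
    F G : I → Vec ℕ n → ℕ
    P Q : I → Vec ℕ n → Set

computable-cong : (∀ i xs → F i xs ≡ G i xs) → Computable oracle F → Computable oracle G
computable-cong F≗G f = computable (code f) λ i xs → subst (Eval _ _ xs) (F≗G i xs) (evaluates f i xs)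

var : (j : Fin n) → Computable oracle (λ _ xs → lookup xs j)
var j = computable (prj j) λ _ _ → ev-prj

compose : {H : I → Vec ℕ k → ℕ} {Gs : Vec (I → Vec ℕ n → ℕ) k} →
          Computable oracle H → All (Computable oracle) Gs →
          Computable oracle (λ i xs → H i (map (λ G → G i xs) Gs))
compose {oracle = oracle} h gs =
  computable (cmp (code h) (reduce code gs)) λ i xs → ev-cmp (evaluate-all gs i xs) (evaluates h i _)
  where
  evaluate-all : ∀ {k} {Gs : Vec _ k} (gs : All (Computable oracle) Gs) i xs →
                 Evals (oracle i) (reduce code gs) xs (map (λ G → G i xs) Gs)
  evaluate-all []       i xs = evs-[]
  evaluate-all (g ∷ gs) i xs = evs-∷ (evaluates g i xs) (evaluate-all gs i xs)

primrec : {G : I → Vec ℕ n → ℕ} {H : I → Vec ℕ (suc (suc n)) → ℕ} (T : I → ℕ → Vec ℕ n → ℕ) →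
          Computable oracle G → Computable oracle H →
          (∀ i xs → T i 0 xs ≡ G i xs) →
          (∀ i k xs → T i (suc k) xs ≡ H i (k ∷ T i k xs ∷ xs)) →
          Computable oracle (λ i xs → T i (head xs) (tail xs))
primrec {oracle = oracle} T g h base step =
  computable (rec (code g) (code h)) λ { i (k ∷ xs) → evaluate i k xs }
  where
  evaluate : ∀ i k xs → Eval (oracle i) (rec (code g) (code h)) (k ∷ xs) (T i k xs)
  evaluate i zero    xs = subst (Eval _ _ _) (sym (base i xs)) (ev-rec0 (evaluates g i xs))
  evaluate i (suc k) xs = subst (Eval _ _ _) (sym (step i k xs)) (ev-recS (evaluate i k xs) (evaluates h i _))

infix  8 1+ᶜ_
infixl 6 _+ᶜ_ _∸ᶜ_
infixl 7 _*ᶜ_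

oracleᶜ : Computable oracle F → Computable oracle (λ i xs → oracle i (F i xs))
oracleᶜ {oracle = oracle} f =
  compose {H = λ i xs → oracle i (lookup xs 0F)} (computable orc λ { _ (x ∷ []) → ev-orc }) (f ∷ [])

1+ᶜ_ : Computable oracle F → Computable oracle (λ i xs → suc (F i xs))
1+ᶜ f = compose {H = λ _ xs → suc (lookup xs 0F)} (computable sucᶜ λ { _ (x ∷ []) → ev-suc }) (f ∷ [])

constᶜ : ∀ k → Computable {I} oracle {n} (λ _ _ → k)
constᶜ zero    = computable zer λ _ _ → ev-zer
constᶜ (suc k) = 1+ᶜ constᶜ k

_+ᶜ_ : Computable oracle F → Computable oracle G → Computable oracle (λ i xs → F i xs + G i xs)
f +ᶜ g = compose (primrec (λ _ k ys → k + lookup ys 0F) (var 0F) (1+ᶜ var 1F)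
                   (λ _ _ → refl) (λ _ _ _ → refl))
                 (f ∷ g ∷ [])

_*ᶜ_ : Computable oracle F → Computable oracle G → Computable oracle (λ i xs → F i xs * G i xs)
f *ᶜ g = compose (primrec (λ _ k ys → k * lookup ys 0F) (constᶜ 0) (var 2F +ᶜ var 1F)
                   (λ _ _ → refl) (λ _ _ _ → refl))
                 (f ∷ g ∷ [])

predᶜ : Computable oracle F → Computable oracle (λ i xs → pred (F i xs))
predᶜ f = compose (primrec (λ _ k _ → pred k) (constᶜ 0) (var 0F) (λ _ _ → refl) (λ _ _ _ → refl)) (f ∷ [])

_∸ᶜ_ : Computable oracle F → Computable oracle G → Computable oracle (λ i xs → F i xs ∸ G i xs)
f ∸ᶜ g = compose (primrec (λ _ k ys → lookup ys 0F ∸ k) (var 0F) (predᶜ (var 1F)) (λ _ _ → refl)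
                   (λ _ k ys → sym (pred[m∸n]≡m∸[1+n] (lookup ys 0F) k)))
                 (g ∷ f ∷ [])

infix 4 _≤ᵈ_ _<ᵈ_ _≡ᵈ_

_≤ᵈ_ : Computable oracle F → Computable oracle G → ComputableDec oracle (λ i xs → F i xs ≤? G i xs)
f ≤ᵈ g = computableDec (computable-cong (λ _ _ → sym (indicator-≤ _ _)) (constᶜ 1 ∸ᶜ (f ∸ᶜ g)))

_<ᵈ_ : Computable oracle F → Computable oracle G → ComputableDec oracle (λ i xs → F i xs <? G i xs)
f <ᵈ g = 1+ᶜ f ≤ᵈ g

infix 3 ¬ᵈ_

¬ᵈ_ : {P? : ∀ i xs → Dec (P i xs)} →
      ComputableDec oracle P? → ComputableDec oracle (λ i xs → ¬? (P? i xs))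
¬ᵈ_ {P? = P?} p =
  computableDec (computable-cong (λ i xs → sym (indicator-¬ (P? i xs))) (constᶜ 1 ∸ᶜ indicatorᶜ p))

module _ {I : Set} {n : ℕ} {P Q : I → Vec ℕ n → Set}
         {P? : ∀ i xs → Dec (P i xs)} {Q? : ∀ i xs → Dec (Q i xs)} where

  infixr 2 _×ᵈ_ _→ᵈ_
  infixr 1 _⊎ᵈ_

  _×ᵈ_ : ComputableDec oracle P? → ComputableDec oracle Q? →
         ComputableDec oracle (λ i xs → P? i xs ×-dec Q? i xs)
  p ×ᵈ q = computableDec (computable-cong (λ i xs → sym (indicator-× (P? i xs) (Q? i xs)))
             (indicatorᶜ p *ᶜ indicatorᶜ q))

  _⊎ᵈ_ : ComputableDec oracle P? → ComputableDec oracle Q? →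
         ComputableDec oracle (λ i xs → P? i xs ⊎-dec Q? i xs)
  p ⊎ᵈ q = computableDec (computable-cong (λ i xs → sym (indicator-⊎ (P? i xs) (Q? i xs)))
             (constᶜ 1 ∸ᶜ (constᶜ 1 ∸ᶜ indicatorᶜ p) *ᶜ (constᶜ 1 ∸ᶜ indicatorᶜ q)))

  _→ᵈ_ : ComputableDec oracle P? → ComputableDec oracle Q? →
         ComputableDec oracle (λ i xs → P? i xs →-dec Q? i xs)
  p →ᵈ q = computableDec (computable-cong (λ i xs → sym (indicator-→ (P? i xs) (Q? i xs)))
             (constᶜ 1 ∸ᶜ indicatorᶜ p *ᶜ (constᶜ 1 ∸ᶜ indicatorᶜ q)))

_≡ᵈ_ : Computable oracle F → Computable oracle G → ComputableDec oracle (λ i xs → F i xs ≟ G i xs)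
f ≡ᵈ g = computableDec (computable-cong (λ _ _ → sym (indicator-≡ _ _)) (indicatorᶜ (f ≤ᵈ g ×ᵈ g ≤ᵈ f)))

μᶜ : {P : I → Vec ℕ (suc n) → Set} {P? : ∀ i ys → Dec (P i ys)} →
     ComputableDec oracle P? → (witness : ∀ i xs → ∃ λ x → P i (x ∷ xs)) →
     Computable oracle (λ i xs → μ (λ x → P? i (x ∷ xs)) (witness i xs))
μᶜ {P? = P?} p witness = computable (mnz (code fails)) λ i xs →
  let holds , minimal = μ-isLeast (λ x → P? i (x ∷ xs)) (witness i xs) in
  ev-mnz (fails-is 0 (indicator-false (¬? (P? i _)) (λ ¬P → ¬P holds)))
    λ x x<μ → 0 , fails-is 1 (indicator-true (¬? (P? i (x ∷ xs))) (minimal x<μ))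
  where
  fails : Computable _ (λ i ys → indicator (¬? (P? i ys)))
  fails = indicatorᶜ (¬ᵈ p)

  fails-is : ∀ {i ys} v → indicator (¬? (P? i ys)) ≡ v → Eval _ (code fails) ys v
  fails-is v refl = evaluates fails _ _

-- A uniform criterion for strong Weihrauch reducibility

open Problem

record Solved (F G : Problem) (Φ : Baire → Baire) : Set where
  field
    input      : Baire
    input∈dom  : dom F input
    answer     : Baire
    answer∈sol : sol G (Φ input) answer

≤sW-intro : ∀ {F G} (Φ : Baire → Baire) (Ψ : Solved F G Φ → Baire) →
            Computable id (λ f (xs : Vec ℕ 1) → Φ f (lookup xs 0F)) →
            Computable Solved.answer (λ i (xs : Vec ℕ 1) → Ψ i (lookup xs 0F)) →
            (∀ {f} → dom F f → dom G (Φ f)) →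
            (∀ i → sol F (Solved.input i) (Ψ i)) →
            F ≤sW G
≤sW-intro Φ Ψ Φᶜ Ψᶜ Φ-dom Ψ-sol = code Φᶜ , code Ψᶜ , λ f f∈dom →
  Φ f , (λ n → evaluates Φᶜ f (n ∷ [])) , Φ-dom f∈dom , λ g g∈sol →
  let i = record { input = f ; input∈dom = f∈dom ; answer = g ; answer∈sol = g∈sol } in
  Ψ i , (λ n → evaluates Ψᶜ i (n ∷ [])) , Ψ-sol i

-- Presenting an order of the naturals on a set of codes

Climbing : Rel ℕ 0ℓ → (ℕ → Set) → Set
Climbing _≼_ T = ∀ {a} → T a → InfinitelyOften (λ b → T b × a ≼ b)

cofinite⇒climbing : ∀ {_≼_ : Rel ℕ 0ℓ} {T} → Total _≼_ → InfinitelyOften T →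
                    (∀ {a} → T a → ∃ λ k → ∀ {b} → T b → b ≼ a → a ≢ b → b < k) → Climbing _≼_ T
cofinite⇒climbing total T-infinite bounded {a} Ta n =
  let k , below     = bounded Ta
      b , late , Tb = T-infinite (n ⊔ (k ⊔ suc a))
      later         = m⊔n≤o⇒n≤o n _ late
      b≮k           = ≤⇒≯ (m⊔n≤o⇒m≤o k _ later)
      a≢b           = <⇒≢ (m⊔n≤o⇒n≤o k _ later)
  in b , m⊔n≤o⇒m≤o n _ late , Tb , [ id , (λ b≼a → contradiction (below Tb b≼a a≢b) b≮k) ] (total a b)

module Presentation
  (encode decode : ℕ → ℕ) (decode-encode : ∀ n → decode (encode n) ≡ n)
  (n≤encode : ∀ n → n ≤ encode n) (encode-mono-≤ : encode Preserves _≤_ ⟶ _≤_)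
  {_≼_ : Rel ℕ 0ℓ} (_≼?_ : ∀ m n → Dec (m ≼ n)) (≼-isTotalOrder : IsTotalOrder _≡_ _≼_) where

  IsCode : ℕ → Set
  IsCode x = encode (decode x) ≡ x

  _≤ᴱ_ : ℕ → ℕ → Set
  x ≤ᴱ y = IsCode x × IsCode y × decode x ≼ decode y

  _≤ᴱ?_ : ∀ x y → Dec (x ≤ᴱ y)
  x ≤ᴱ? y = encode (decode x) ≟ x ×-dec encode (decode y) ≟ y ×-dec decode x ≼? decode y

  presentation : Baire
  presentation p = indicator (unpair₁ p ≤ᴱ? unpair₂ p)

  open LinOrd presentation
  private module ≼ = IsTotalOrder ≼-isTotalOrder

  ≤L⇒≤ᴱ : ∀ x y → x ≤L y → x ≤ᴱ y
  ≤L⇒≤ᴱ x y = subst₂ _≤ᴱ_ (unpair₁-pair x y) (unpair₂-pair x y) ∘ indicator≡1⇒ (_ ≤ᴱ? _)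

  ≤ᴱ⇒≤L : ∀ x y → x ≤ᴱ y → x ≤L y
  ≤ᴱ⇒≤L x y = indicator-true (_ ≤ᴱ? _) ∘ subst₂ _≤ᴱ_ (sym (unpair₁-pair x y)) (sym (unpair₂-pair x y))

  InL⇒isCode : ∀ x → InL x → IsCode x
  InL⇒isCode x = proj₁ ∘ ≤L⇒≤ᴱ x x

  isCode⇒InL : ∀ x → IsCode x → InL x
  isCode⇒InL x x-code = ≤ᴱ⇒≤L x x (x-code , x-code , ≼.refl)

  encode-isCode : ∀ n → IsCode (encode n)
  encode-isCode n = cong encode (decode-encode n)

  encode-injective : ∀ {m n} → encode m ≡ encode n → m ≡ n
  encode-injective {m} {n} eq = trans (sym (decode-encode m)) (trans (cong decode eq) (decode-encode n))

  encode-mono-≼ : ∀ {m n} → m ≼ n → encode m ≤L encode n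
  encode-mono-≼ {m} {n} m≼n = ≤ᴱ⇒≤L (encode m) (encode n) (encode-isCode m , encode-isCode n ,
    subst₂ _≼_ (sym (decode-encode m)) (sym (decode-encode n)) m≼n)

  isLinearOrder : IsLinearOrder
  isLinearOrder = (λ p → indicator≤1 (unpair₁ p ≤ᴱ? unpair₂ p)) , field-of , antisym , transitive , total
    where
    field-of : ∀ x y → x ≤L y → InL x × InL y
    field-of x y x≤y =
      let x-code , y-code , _ = ≤L⇒≤ᴱ x y x≤y in isCode⇒InL x x-code , isCode⇒InL y y-code

    antisym : ∀ x y → x ≤L y → y ≤L x → x ≡ y
    antisym x y x≤y y≤x =
      let x-code , y-code , i = ≤L⇒≤ᴱ x y x≤y
          _ , _ , j = ≤L⇒≤ᴱ y x y≤x
      in trans (sym x-code) (trans (cong encode (≼.antisym i j)) y-code)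

    transitive : ∀ x y z → x ≤L y → y ≤L z → x ≤L z
    transitive x y z x≤y y≤z =
      let x-code , _ , i = ≤L⇒≤ᴱ x y x≤y
          _ , z-code , j = ≤L⇒≤ᴱ y z y≤z
      in ≤ᴱ⇒≤L x z (x-code , z-code , ≼.trans i j)

    total : ∀ x y → InL x → InL y → x ≤L y ⊎ y ≤L x
    total x y x∈L y∈L = Sum.map
      (λ i → ≤ᴱ⇒≤L x y (InL⇒isCode x x∈L , InL⇒isCode y y∈L , i))
      (λ j → ≤ᴱ⇒≤L y x (InL⇒isCode y y∈L , InL⇒isCode x x∈L , j))
      (≼.total (decode x) (decode y))

  infiniteL : InfiniteL
  infiniteL n = encode n , n≤encode n , isCode⇒InL (encode n) (encode-isCode n)

  module InfiniteSubset (s : Baire) (s-infinite : InfiniteSet s) (s⊆L : ∀ x → x ∈ₛ s → InL x) where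

    Decoded : ℕ → Set
    Decoded n = encode n ∈ₛ s

    member-isCode : ∀ {x} → x ∈ₛ s → IsCode x
    member-isCode {x} x∈s = InL⇒isCode x (s⊆L x x∈s)

    decode-member : ∀ {x} → x ∈ₛ s → Decoded (decode x)
    decode-member x∈s = subst (_∈ₛ s) (sym (member-isCode x∈s)) x∈s

    decode-unbounded : ∀ n → ∃ λ x → x ∈ₛ s × n ≤ decode x
    decode-unbounded n with x , n<x , x∈s ← s-infinite (suc (encode n)) = x , x∈s , ≮⇒≥ λ x<n →
      <⇒≱ n<x (subst (_≤ encode n) (member-isCode x∈s) (encode-mono-≤ (<⇒≤ x<n)))

    decoded-infinite : InfinitelyOften Decoded
    decoded-infinite n = let x , x∈s , n≤x = decode-unbounded n in decode x , n≤x , decode-member x∈s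

    ascending⇒climbing : Ascending s → Climbing _≼_ Decoded
    ascending⇒climbing ascending = cofinite⇒climbing ≼.total decoded-infinite λ {a} a∈s →
      let k , below = ascending (encode a) a∈s in
      k , λ {b} b∈s b≼a a≢b →
        ≤-<-trans (n≤encode b) (below (encode b) b∈s (encode-mono-≼ b≼a , a≢b ∘ sym ∘ encode-injective))

    descending⇒climbing : Descending s → Climbing (flip _≼_) Decoded
    descending⇒climbing descending = cofinite⇒climbing (flip ≼.total) decoded-infinite λ {a} a∈s →
      let k , above = descending (encode a) a∈s in
      k , λ {b} b∈s a≼b a≢b →
        ≤-<-trans (n≤encode b) (above (encode b) b∈s (encode-mono-≼ a≼b , a≢b ∘ encode-injective))

-- Nested orders

≡-isTotalOrder : ∀ {A : Set} {_≲_ : Rel A 0ℓ} →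
                 Transitive _≲_ → Antisymmetric _≡_ _≲_ → Total _≲_ → IsTotalOrder _≡_ _≲_
≡-isTotalOrder ≲-trans ≲-antisym ≲-total = record
  { isPartialOrder = record
    { isPreorder = record
      { isEquivalence = isEquivalence
      ; reflexive     = λ { {a} refl → Sum.reduce (≲-total a a) }
      ; trans         = ≲-trans
      }
    ; antisym = ≲-antisym
    }
  ; total = ≲-total
  }

module Nested {A : Set} (_⊑_ : Rel A 0ℓ) (Lower Upper : A → Set) where

  infix 4 _≼_

  -- The upper points, ordered by ⊑, lie above the lower points, ordered by the reverse of ⊑.
  -- Exchanging Lower and Upper swaps the two components and reverses ≼.
  _≼_ : Rel A 0ℓ
  a ≼ b = (Lower b → Lower a × b ⊑ a) × (Upper a → Upper b × a ⊑ b)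

  module _ (cover : ∀ a → Lower a ⊎ Upper a) (disjoint : ∀ {a} → Lower a → ¬ Upper a)
           (⊑-isTotalOrder : IsTotalOrder _≡_ _⊑_) where

    private module ⊑ = IsTotalOrder ⊑-isTotalOrder

    ≼-trans : Transitive _≼_
    ≼-trans (b↓ , a↑) (c↓ , b↑) =
      (λ c-lower → let b-lower , c⊑b = c↓ c-lower ; a-lower , b⊑a = b↓ b-lower in a-lower , ⊑.trans c⊑b b⊑a) ,
      (λ a-upper → let b-upper , a⊑b = a↑ a-upper ; c-upper , b⊑c = b↑ b-upper in c-upper , ⊑.trans a⊑b b⊑c)

    ≼-antisym : Antisymmetric _≡_ _≼_
    ≼-antisym {a} (b↓ , a↑) (a↓ , b↑) with cover a
    ... | inj₁ a-lower = let b-lower , a⊑b = a↓ a-lower in ⊑.antisym a⊑b (proj₂ (b↓ b-lower))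
    ... | inj₂ a-upper = let b-upper , a⊑b = a↑ a-upper in ⊑.antisym a⊑b (proj₂ (b↑ b-upper))

    lower≼upper : ∀ {a b} → Lower a → Upper b → a ≼ b
    lower≼upper a-lower b-upper =
      (λ b-lower → contradiction b-upper (disjoint b-lower)) ,
      (λ a-upper → contradiction a-upper (disjoint a-lower))

    lower-antitone : ∀ {a b} → Lower a → Lower b → b ⊑ a → a ≼ b
    lower-antitone a-lower b-lower b⊑a =
      (λ _ → a-lower , b⊑a) , (λ a-upper → contradiction a-upper (disjoint a-lower))

    upper-monotone : ∀ {a b} → Upper a → Upper b → a ⊑ b → a ≼ b
    upper-monotone a-upper b-upper a⊑b =
      (λ b-lower → contradiction b-upper (disjoint b-lower)) , (λ _ → b-upper , a⊑b)

    ≼-total : Total _≼_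
    ≼-total a b with cover a | cover b | ⊑.total a b
    ... | inj₁ a↓ | inj₂ b↑ | _        = inj₁ (lower≼upper a↓ b↑)
    ... | inj₂ a↑ | inj₁ b↓ | _        = inj₂ (lower≼upper b↓ a↑)
    ... | inj₁ a↓ | inj₁ b↓ | inj₁ a⊑b = inj₂ (lower-antitone b↓ a↓ a⊑b)
    ... | inj₁ a↓ | inj₁ b↓ | inj₂ b⊑a = inj₁ (lower-antitone a↓ b↓ b⊑a)
    ... | inj₂ a↑ | inj₂ b↑ | inj₁ a⊑b = inj₁ (upper-monotone a↑ b↑ a⊑b)
    ... | inj₂ a↑ | inj₂ b↑ | inj₂ b⊑a = inj₂ (upper-monotone b↑ a↑ b⊑a)

    ≼-isTotalOrder : IsTotalOrder _≡_ _≼_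
    ≼-isTotalOrder = ≡-isTotalOrder ≼-trans ≼-antisym ≼-total

-- The phases of a colouring

-- The point n belongs to phase f n, the phase after its colour has been read.
phaseBefore phase : Baire → ℕ → ℕ
phaseBefore f zero    = 0
phaseBefore f (suc n) = indicator (f n ≟ phaseBefore f n % 3) + phaseBefore f n
phase f n             = phaseBefore f (suc n)

phaseBefore-mono-≤ : ∀ f → phaseBefore f Preserves _≤_ ⟶ _≤_
phaseBefore-mono-≤ f = step⇒mono (phaseBefore f) λ n → m≤n+m (phaseBefore f n) _

phase-change : ∀ f {n u} → phaseBefore f n ≤ u → u < phase f n → f n ≡ u % 3
phase-change f {n} before≤u u<phase with f n ≟ phaseBefore f n % 3
... | yes fn = trans fn (cong (_% 3) (≤-antisym before≤u (≤-pred u<phase)))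
... | no  _  = contradiction u<phase (≤⇒≯ before≤u)

Recurs : Baire → ℕ → Set
Recurs f c = InfinitelyOften (λ m → f m ≡ c)

-- Colour c is read whenever a phase congruent to c modulo 3 is left.
unbounded⇒recurs : ∀ f → (∀ u → ∃ λ n → u < phase f n) → ∀ {c} → c < 3 → Recurs f c
unbounded⇒recurs f unbounded {c} c<3 n =
  let p                            = phaseBefore f n
      b , u<phase                  = unbounded (c + p * 3)
      m , n≤m , before≤u , u<after = crossing (phaseBefore f) (≤⇒≤′ (m≤m⊔n n (suc b)))
        (m≤n⇒m≤o+n c (m≤m*n p 3)) (<-≤-trans u<phase (phaseBefore-mono-≤ f (m≤n⊔m n (suc b))))
  in m , n≤m , trans (phase-change f before≤u u<after) (trans ([m+kn]%n≡m%n c p 3) (m<n⇒m%n≡m c<3))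

-- Here, in consecutive-residues and in suc-%3, (3 + p) % 3 reduces to p % 3.
p%3≢[1+p]%3 : ∀ p → p % 3 ≢ (1 + p) % 3
p%3≢[1+p]%3 0                   = λ ()
p%3≢[1+p]%3 1                   = λ ()
p%3≢[1+p]%3 2                   = λ ()
p%3≢[1+p]%3 (suc (suc (suc p))) = p%3≢[1+p]%3 p

consecutive-residues : ∀ p {x} → x < 3 → x ≡ p % 3 ⊎ x ≡ (1 + p) % 3 ⊎ x ≡ (2 + p) % 3
consecutive-residues zero {0} _ = inj₁ refl
consecutive-residues zero {1} _ = inj₂ (inj₁ refl)
consecutive-residues zero {2} _ = inj₂ (inj₂ refl)
consecutive-residues zero {suc (suc (suc _))} (s≤s (s≤s (s≤s ())))
consecutive-residues (suc p) x<3 with consecutive-residues p x<3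
... | inj₁ x≡p          = inj₂ (inj₂ x≡p)
... | inj₂ (inj₁ x≡1+p) = inj₁ x≡1+p
... | inj₂ (inj₂ x≡2+p) = inj₂ (inj₁ x≡2+p)

phase-excludes : ∀ f n → f n ≢ phase f n % 3
phase-excludes f n with f n ≟ phaseBefore f n % 3
... | yes fn = λ eq → p%3≢[1+p]%3 (phaseBefore f n) (trans (sym fn) eq)
... | no ¬fn = ¬fn

-- The order of a colouring

_⊢_⊑_ : Baire → ℕ → ℕ → Set
f ⊢ a ⊑ b = ×-Lex _≡_ _<_ _≥_ (phase f a , a) (phase f b , b)

_⊢_⊑?_ : ∀ f a b → Dec (f ⊢ a ⊑ b)
f ⊢ a ⊑? b = ×-decidable _≟_ _<?_ _≥?_ (phase f a , a) (phase f b , b)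

⊑-isTotalOrder : ∀ f → IsTotalOrder _≡_ (f ⊢_⊑_)
⊑-isTotalOrder f = ≡-isTotalOrder
  (×-transitive {_<₂_ = _≥_} isEquivalence <-resp₂-≡ <-trans (flip ≤-trans))
  (λ a⊑b b⊑a → proj₂ (lex-antisym a⊑b b⊑a))
  (λ _ _ → ×-total₂ sym <-cmp (flip ≤-total) _ _)
  where
  lex-antisym : Antisymmetric (Pointwise _≡_ _≡_) (×-Lex _≡_ _<_ _≥_)
  lex-antisym = ×-antisymmetric {_≈₁_ = _≡_} {_<₂_ = _≥_} sym <-irrefl <-asym (flip ≤-antisym)

⊑-later : ∀ f {a b} → a < b → f ⊢ a ⊑ b → phase f a < phase f b
⊑-later f a<b (inj₁ phase<)    = phase<
⊑-later f a<b (inj₂ (_ , b≤a)) = contradiction b≤a (<⇒≱ a<b)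

⊒-later : ∀ f {a b} → a < b → f ⊢ b ⊑ a → phase f a ≡ phase f b
⊒-later f a<b (inj₁ phase>)   = contradiction phase> (≤⇒≯ (phaseBefore-mono-≤ f (s≤s (<⇒≤ a<b))))
⊒-later f a<b (inj₂ (eq , _)) = sym eq

Lower Upper : Baire → ℕ → Set
Lower f n = f n ≡ (1 + phase f n) % 3
Upper f n = ¬ Lower f n

lower? : ∀ f n → Dec (Lower f n)
lower? f n = f n ≟ (1 + phase f n) % 3

upper? : ∀ f n → Dec (Upper f n)
upper? f n = ¬? (lower? f n)

lower-or-upper : ∀ f n → Lower f n ⊎ Upper f n
lower-or-upper f n = toSum (lower? f n)

_⊢_≼_ : Baire → ℕ → ℕ → Set
f ⊢ a ≼ b = Nested._≼_ (f ⊢_⊑_) (Lower f) (Upper f) a b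

_⊢_≼?_ : ∀ f a b → Dec (f ⊢ a ≼ b)
f ⊢ a ≼? b = (lower? f b →-dec (lower? f a ×-dec f ⊢ b ⊑? a)) ×-dec
             (upper? f a →-dec (upper? f b ×-dec f ⊢ a ⊑? b))

≼-isTotalOrder : ∀ f → IsTotalOrder _≡_ (f ⊢_≼_)
≼-isTotalOrder f =
  Nested.≼-isTotalOrder (f ⊢_⊑_) (Lower f) (Upper f) (lower-or-upper f) contradiction (⊑-isTotalOrder f)

Colouring : Baire → Set
Colouring f = ∀ n → f n < 3

Monochromatic : Baire → (ℕ → Set) → Set
Monochromatic f Side = ∀ {a b} → Side a → Side b → phase f a ≡ phase f b → f a ≡ f b

lower-monochromatic : ∀ f → Monochromatic f (Lower f)
lower-monochromatic f a-lower b-lower same =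
  trans a-lower (trans (cong (λ p → (1 + p) % 3) same) (sym b-lower))

upper-monochromatic : ∀ {f} → Colouring f → Monochromatic f (Upper f)
upper-monochromatic {f} f<3 {a} {b} a-upper b-upper same =
  trans (upper-colour a a-upper) (trans (cong (λ p → (2 + p) % 3) same) (sym (upper-colour b b-upper)))
  where
  upper-colour : ∀ n → Upper f n → f n ≡ (2 + phase f n) % 3
  upper-colour n n-upper with consecutive-residues (phase f n) (f<3 n)
  ... | inj₁ eq        = contradiction eq (phase-excludes f n)
  ... | inj₂ (inj₁ eq) = contradiction eq n-upper
  ... | inj₂ (inj₂ eq) = eq

module _ {f : Baire} (f<3 : Colouring f) {Bottom Top : ℕ → Set} (cover : ∀ n → Bottom n ⊎ Top n)
         (bottom-monochromatic : Monochromatic f Bottom)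
         {T : ℕ → Set} (climbing : Climbing (Nested._≼_ (f ⊢_⊑_) Bottom Top) T) where

  top⇒unbounded : ∀ {a} → T a → Top a → ∀ u → ∃ λ b → T b × Top b × u ≤ phase f b
  top⇒unbounded {a} Ta a-top zero = a , Ta , a-top , z≤n
  top⇒unbounded Ta a-top (suc u)
    with b , Tb , b-top , u≤b ← top⇒unbounded Ta a-top u
    with c , b<c , Tc , _ , b↑ ← climbing Tb (suc b)
    with c-top , b⊑c ← b↑ b-top
    = c , Tc , c-top , ≤-<-trans u≤b (⊑-later f b<c b⊑c)

  climbing⇒recurs : ∀ {a} → T a → Recurs f (f a)
  climbing⇒recurs {a} Ta n with b , late , Tb , b↓ , _ ← climbing Ta (n ⊔ suc a) with cover b
  ... | inj₁ b-bottom = let a-bottom , b⊑a = b↓ b-bottom in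
    b , m⊔n≤o⇒m≤o n _ late , bottom-monochromatic b-bottom a-bottom (sym (⊒-later f (m⊔n≤o⇒n≤o n _ late) b⊑a))
  ... | inj₂ b-top = unbounded⇒recurs f unbounded (f<3 a) n
    where
    unbounded : ∀ u → ∃ λ c → u < phase f c
    unbounded u = let c , _ , _ , u<c = top⇒unbounded Tb b-top (suc u) in c , u<c

-- Coding a point together with the colours read so far

history encode : Baire → ℕ → ℕ
history f zero    = 0
history f (suc n) = pair (f n) (history f n)
encode f n        = pair n (history f (suc n))

decode : ℕ → ℕ
decode = unpair₁

-- Meaningful for m ≤ decode x only: otherwise the truncated difference is 0.
recall : ℕ → ℕ → ℕ
recall x m = unpair₁ (fold (unpair₂ x) unpair₂ (decode x ∸ m))

decode-encode : ∀ f n → decode (encode f n) ≡ n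
decode-encode f n = unpair₁-pair n (history f (suc n))

n≤encode : ∀ f n → n ≤ encode f n
n≤encode f n = x≤pair n (history f (suc n))

encode-mono-≤ : ∀ f → encode f Preserves _≤_ ⟶ _≤_
encode-mono-≤ f m≤n = pair-mono-≤ m≤n (history-mono-≤ (s≤s m≤n))
  where
  history-mono-≤ : history f Preserves _≤_ ⟶ _≤_
  history-mono-≤ = step⇒mono (history f) λ n → y≤pair (f n) (history f n)

history-drop : ∀ f k m → fold (history f (k + m)) unpair₂ k ≡ history f m
history-drop f zero    m = refl
history-drop f (suc k) m = begin
  unpair₂ (fold (history f (suc k + m)) unpair₂ k)  ≡⟨ cong (λ l → unpair₂ (fold (history f l) unpair₂ k)) (+-suc k m) ⟨
  unpair₂ (fold (history f (k + suc m)) unpair₂ k)  ≡⟨ cong unpair₂ (history-drop f k (suc m)) ⟩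
  unpair₂ (history f (suc m))                       ≡⟨ unpair₂-pair (f m) (history f m) ⟩
  history f m                                       ∎
  where open ≡-Reasoning

recall-code : ∀ f {x m} → encode f (decode x) ≡ x → m ≤ decode x → recall x m ≡ f m
recall-code f {x} {m} x-code m≤x = begin
  unpair₁ (fold (unpair₂ x) unpair₂ drops)                  ≡⟨ cong (λ h → unpair₁ (fold h unpair₂ drops)) x-history ⟩
  unpair₁ (fold (history f (drops + suc m)) unpair₂ drops)  ≡⟨ cong unpair₁ (history-drop f drops (suc m)) ⟩
  unpair₁ (history f (suc m))                               ≡⟨ unpair₁-pair (f m) (history f m) ⟩
  f m                                                       ∎
  where
  open ≡-Reasoning

  drops : ℕ
  drops = decode x ∸ m

  x-history : unpair₂ x ≡ history f (drops + suc m)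
  x-history = begin
    unpair₂ x                      ≡⟨ cong unpair₂ x-code ⟨
    unpair₂ (encode f (decode x))  ≡⟨ unpair₂-pair (decode x) (history f (suc (decode x))) ⟩
    history f (suc (decode x))     ≡⟨ cong (history f ∘ suc) (m∸n+n≡m m≤x) ⟨
    history f (suc (drops + m))    ≡⟨ cong (history f) (+-suc drops m) ⟨
    history f (drops + suc m)      ∎

module Order (f : Baire) =
  Presentation (encode f) decode (decode-encode f) (n≤encode f) (encode-mono-≤ f) (f ⊢_≼?_) (≼-isTotalOrder f)

order : Baire → Baire
order f = Order.presentation f

order∈dom : ∀ f → dom ADC (order f)
order∈dom f = isLinearOrder , infiniteL
  where open Order f

-- Computability of the order

triᶜ : Computable oracle F → Computable oracle (λ i xs → tri (F i xs))
triᶜ f = compose (primrec (λ _ k _ → tri k) (constᶜ 0) (1+ᶜ var 0F +ᶜ var 1F)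
                   (λ _ _ → refl) (λ _ _ _ → refl))
                 (f ∷ [])

pairᶜ : Computable oracle F → Computable oracle G → Computable oracle (λ i xs → pair (F i xs) (G i xs))
pairᶜ f g = triᶜ (f +ᶜ g) +ᶜ g

diagonalᶜ : Computable oracle F → Computable oracle (λ i xs → diagonal (F i xs))
diagonalᶜ f = compose (μᶜ (var 1F <ᵈ triᶜ (1+ᶜ var 0F))
                        λ _ xs → lookup xs 0F , n≤tri (suc (lookup xs 0F)))
                      (f ∷ [])

unpair₂ᶜ : Computable oracle F → Computable oracle (λ i xs → unpair₂ (F i xs))
unpair₂ᶜ f = f ∸ᶜ triᶜ (diagonalᶜ f)

unpair₁ᶜ : Computable oracle F → Computable oracle (λ i xs → unpair₁ (F i xs))
unpair₁ᶜ f = diagonalᶜ f ∸ᶜ unpair₂ᶜ f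

_%3ᶜ : Computable oracle F → Computable oracle (λ i xs → F i xs % 3)
f %3ᶜ = compose (primrec (λ _ k _ → k % 3) (constᶜ 0) (indicatorᶜ (var 1F <ᵈ constᶜ 2) *ᶜ (1+ᶜ var 1F))
                  (λ _ _ → refl) (λ _ k _ → suc-%3 k))
                (f ∷ [])
  where
  suc-%3 : ∀ n → suc n % 3 ≡ indicator (n % 3 <? 2) * suc (n % 3)
  suc-%3 0                   = refl
  suc-%3 1                   = refl
  suc-%3 2                   = refl
  suc-%3 (suc (suc (suc n))) = suc-%3 n

historyᶜ : Computable oracle F → Computable oracle (λ i xs → history (oracle i) (F i xs))
historyᶜ {oracle = oracle} f =
  compose (primrec (λ i k _ → history (oracle i) k) (constᶜ 0) (pairᶜ (oracleᶜ (var 0F)) (var 1F))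
            (λ _ _ → refl) (λ _ _ _ → refl))
          (f ∷ [])

encodeᶜ : Computable oracle F → Computable oracle (λ i xs → encode (oracle i) (F i xs))
encodeᶜ f = pairᶜ f (historyᶜ (1+ᶜ f))

phaseᶜ : Computable oracle F → Computable oracle (λ i xs → phase (oracle i) (F i xs))
phaseᶜ {oracle = oracle} f =
  compose (primrec (λ i k _ → phaseBefore (oracle i) k) (constᶜ 0)
            (indicatorᶜ (oracleᶜ (var 0F) ≡ᵈ var 1F %3ᶜ) +ᶜ var 1F) (λ _ _ → refl) (λ _ _ _ → refl))
          (1+ᶜ f ∷ [])

lowerᵈ : Computable oracle F → ComputableDec oracle (λ i xs → lower? (oracle i) (F i xs))
lowerᵈ f = oracleᶜ f ≡ᵈ (1+ᶜ phaseᶜ f) %3ᶜ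

⊑ᵈ : Computable oracle F → Computable oracle G → ComputableDec oracle (λ i xs → oracle i ⊢ F i xs ⊑? G i xs)
⊑ᵈ f g = phaseᶜ f <ᵈ phaseᶜ g ⊎ᵈ phaseᶜ f ≡ᵈ phaseᶜ g ×ᵈ g ≤ᵈ f

≼ᵈ : Computable oracle F → Computable oracle G → ComputableDec oracle (λ i xs → oracle i ⊢ F i xs ≼? G i xs)
≼ᵈ f g = (lowerᵈ g →ᵈ lowerᵈ f ×ᵈ ⊑ᵈ g f) ×ᵈ (¬ᵈ lowerᵈ f →ᵈ (¬ᵈ lowerᵈ g) ×ᵈ ⊑ᵈ f g)

orderᶜ : Computable oracle F → Computable oracle (λ i xs → order (oracle i) (F i xs))
orderᶜ f = indicatorᶜ (isCodeᵈ (unpair₁ᶜ f) ×ᵈ isCodeᵈ (unpair₂ᶜ f) ×ᵈ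
                       ≼ᵈ (unpair₁ᶜ (unpair₁ᶜ f)) (unpair₁ᶜ (unpair₂ᶜ f)))
  where
  isCodeᵈ : Computable oracle F → ComputableDec oracle (λ i xs → encode (oracle i) (decode (F i xs)) ≟ F i xs)
  isCodeᵈ f = encodeᶜ (unpair₁ᶜ f) ≡ᵈ f

-- Reading a homogeneous set off a chain

open Solved

SolvedOrder : Set
SolvedOrder = Solved RT13 ADC order

module _ (i : SolvedOrder) where

  open LinOrd (order (input i))

  answer-infinite : InfiniteSet (answer i)
  answer-infinite = proj₁ (proj₂ (answer∈sol i))

  answer⊆L : ∀ x → x ∈ₛ answer i → InL x
  answer⊆L = proj₁ (proj₂ (proj₂ (answer∈sol i)))

  answer-isChain : Ascending (answer i) ⊎ Descending (answer i)
  answer-isChain = proj₂ (proj₂ (proj₂ (answer∈sol i)))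

  open Order.InfiniteSubset (input i) (answer i) answer-infinite answer⊆L

  chain⇒recurs : Ascending (answer i) ⊎ Descending (answer i) → ∀ {a} → Decoded a → Recurs (input i) (input i a)
  chain⇒recurs (inj₁ ascending) = climbing⇒recurs (input∈dom i) (lower-or-upper (input i))
    (lower-monochromatic (input i)) (ascending⇒climbing ascending)
  chain⇒recurs (inj₂ descending) = climbing⇒recurs (input∈dom i) (Sum.swap ∘ lower-or-upper (input i))
    (upper-monochromatic (input∈dom i)) λ a∈s n →
      let b , n≤b , b∈s , b≼a = descending⇒climbing descending a∈s n in b , n≤b , b∈s , Product.swap b≼a

  IsLate : ℕ → ℕ → Set
  IsLate m x = x ∈ₛ answer i × m ≤ decode x

  isLate? : ∀ m x → Dec (IsLate m x)
  isLate? m x = answer i x ≟ 1 ×-dec m ≤? decode x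

  late-exists : ∀ m → ∃ (IsLate m)
  late-exists = decode-unbounded

  lateMember : ℕ → ℕ
  lateMember m = μ (isLate? m) (late-exists m)

  lateMember-isLate : ∀ m → IsLate m (lateMember m)
  lateMember-isLate m = proj₁ (μ-isLeast (isLate? m) (late-exists m))

  recall-lateMember : ∀ m → recall (lateMember m) m ≡ input i m
  recall-lateMember m =
    let x∈s , m≤x = lateMember-isLate m in recall-code (input i) (member-isCode x∈s) m≤x

  pivot : ℕ
  pivot = decode (lateMember 0)

  pivot-recurs : Recurs (input i) (input i pivot)
  pivot-recurs = chain⇒recurs answer-isChain {pivot} (decode-member (proj₁ (lateMember-isLate 0)))

  colourClass : Baire
  colourClass m = indicator (input i m ≟ input i pivot)

  colourClass∈sol : sol RT13 (input i) colourClass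
  colourClass∈sol =
    (λ m → indicator≤1 (input i m ≟ input i pivot)) ,
    (λ n → let m , n≤m , same = pivot-recurs n in m , n≤m , indicator-true (input i m ≟ input i pivot) same) ,
    input i pivot , λ m → indicator≡1⇒ (input i m ≟ input i pivot)

recallᶜ : Computable oracle F → Computable oracle G → Computable oracle (λ i xs → recall (F i xs) (G i xs))
recallᶜ f g = unpair₁ᶜ (compose
  (primrec (λ _ k ys → fold (lookup ys 0F) unpair₂ k) (var 0F) (unpair₂ᶜ (var 1F))
    (λ _ _ → refl) (λ _ _ _ → refl))
  (unpair₁ᶜ f ∸ᶜ g ∷ unpair₂ᶜ f ∷ []))

private
  variable
    S : SolvedOrder → Vec ℕ n → ℕ

lateMemberᶜ : Computable answer S → Computable answer (λ i xs → lateMember i (S i xs))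
lateMemberᶜ f = compose (μᶜ (oracleᶜ (var 0F) ≡ᵈ constᶜ 1 ×ᵈ var 1F ≤ᵈ unpair₁ᶜ (var 0F))
                          λ i xs → late-exists i (lookup xs 0F))
                        (f ∷ [])

inputᶜ : Computable answer S → Computable answer (λ i xs → input i (S i xs))
inputᶜ f = computable-cong (λ i _ → recall-lateMember i _) (recallᶜ (lateMemberᶜ f) f)

colourClassᶜ : Computable answer S → Computable answer (λ i xs → colourClass i (S i xs))
colourClassᶜ f = indicatorᶜ (inputᶜ f ≡ᵈ inputᶜ (unpair₁ᶜ (lateMemberᶜ (constᶜ 0))))

theorem4p22 : RT13 ≤sW ADC
theorem4p22 = ≤sW-intro order colourClass (orderᶜ (var 0F)) (colourClassᶜ (var 0F))
  (λ {f} _ → order∈dom f) colourClass∈sol
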